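{- Let $k\in\mathbb{N}$ and let $\mathcal{R}$ be a binary structure of type $k$ on a set $V$. Then the relations $\simeq_{\le 3,\mathcal{R}}$ and $\simeq_{\mathcal{R}}$ on $V$ coincide.
   Context: A binary structure of type $k$ is $\mathcal{R}=(V,\rho_1,\dots,\rho_k)$ with binary relations $\rho_i$ on $V$. For $x,y\in V$ and $F\subseteq V\setminus\{x,y\}$, $x\simeq_{F,\mathcal{R}}y$ means that the restrictions of $\mathcal{R}$ to $\{x\}\cup F$ and to $\{y\}\cup F$ are isomorphic. For an integer $m$, $x\simeq_{m,\mathcal{R}}y$ means $x\simeq_{F,\mathcal{R}}y$ for every $m$-element $F\subseteq V\setminus\{x,y\}$; $x\simeq_{\le m,\mathcal{R}}y$ means $x\simeq_{m',\mathcal{R}}y$ for all $m'\le m$; $x\simeq_{\mathcal{R}}y$ means $x\simeq_{m,\mathcal{R}}y$ for all integers $m$. -}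

module Defs where

open import Data.Nat using (ℕ; suc; _≤_)
open import Data.Fin using (Fin)
open import Data.Vec.Functional using (_∷_)
open import Data.Product using (Σ; _×_)
open import Relation.Binary.PropositionalEquality using (_≡_; _≢_)
open import Function.Bundles using (_↔_; _⇔_; Inverse)
open import Function.Definitions using (Injective)

BinStr : ℕ → Set → Set₁
BinStr k V = Fin k → V → V → Set

Iso : {k : ℕ} {A B : Set} → BinStr k A → BinStr k B → Set
Iso {k} {A} {B} R S =
  Σ (A ↔ B) λ σ → ∀ (i : Fin k) (a b : A) →
    R i a b ⇔ S i (Inverse.to σ a) (Inverse.to σ b)

-- Restriction of R to the finite subset enumerated (injectively) by g,
-- transported to the index set Fin n along g.
restrict : {k n : ℕ} {V : Set} → BinStr k V → (Fin n → V) → BinStr k (Fin n)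
restrict R g i a b = R i (g a) (g b)

SubsetAvoiding : {V : Set} → V → V → (m : ℕ) → (Fin m → V) → Set
SubsetAvoiding x y m f =
  Injective _≡_ _≡_ f × (∀ i → f i ≢ x) × (∀ i → f i ≢ y)

SimF : {k m : ℕ} {V : Set} → BinStr k V → V → V → (Fin m → V) → Set
SimF R x y f = Iso (restrict R (x ∷ f)) (restrict R (y ∷ f))

Sim : {k : ℕ} {V : Set} → BinStr k V → ℕ → V → V → Set
Sim {V = V} R m x y =
  (f : Fin m → V) → SubsetAvoiding x y m f → SimF R x y f

Sim≤ : {k : ℕ} {V : Set} → BinStr k V → ℕ → V → V → Set
Sim≤ R m x y = ∀ (m' : ℕ) → m' ≤ m → Sim R m' x y

SimAll : {k : ℕ} {V : Set} → BinStr k V → V → V → Set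
SimAll R x y = ∀ (m : ℕ) → Sim R m x y

{-# OPTIONS --safe #-}
module Submission where

-- R is undecidable, but a finite F has only finitely many subsets of size at most 3, hence
-- finitely many given isomorphisms. Start from the colouring of the arcs on x, y and F in which
-- each arc has its own colour, and merge the colours of each arc and of its image under these
-- isomorphisms: the result is a decidable colouring that determines R and is still preserved
-- by all of them. So R may be replaced by a colouring.
--
-- Call a vertex i good if the arcs x i and y i have the same colour, else bad. The 1-element
-- sets show that at a bad vertex these colours α ≠ α* are reverses of each other; the 2-element
-- sets show that x, y and the bad vertices look alike from a good vertex, and that two bad
-- vertices either have the same α and are joined by α or α*, or have opposite α and are joined
-- symmetrically. By the 3-element sets the bad vertices of a given α contain no 3-cycle, and no
-- two of them coexist with one for α*. Hence if all bad vertices have the same α, they form a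
-- linear order, which x extends by a minimum and y by a maximum, and these chains are
-- isomorphic. Otherwise there are just two bad vertices, and exchanging them is an isomorphism.

open import Defs
open import Data.Nat using (ℕ; zero; suc; _≤_; z≤n; s≤s)
import Data.Nat as ℕ
import Data.Nat.Properties as ℕ
open import Data.Fin using (Fin; zero; suc; toℕ; fromℕ<; punchOut; #_)
import Data.Fin as Fin
open import Data.Fin.Properties
  using (_≟_; any?; all?; injective⇒≤; punchOut-injective; fromℕ<-injective;
         suc-injective; <-cmp)
import Data.Fin.Properties as Fin
open import Data.Fin.Permutation using (transpose)
open import Data.Fin.Subset using (Subset; ∣_∣; _∈_)
open import Data.Fin.Subset.Properties using (p⊂q⇒∣p∣<∣q∣; ∣⊤∣≡n; ∈⊤; ⊆⊤)
open import Data.Vec as Vec using (Vec; []; _∷_; lookup)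
open import Data.Vec.Relation.Unary.All using ([]; _∷_)
open import Data.Vec.Relation.Unary.AllPairs using (allPairs?)
open import Data.Vec.Relation.Unary.Unique.Propositional using (Unique; []; _∷_)
open import Data.Vec.Relation.Unary.Unique.Propositional.Properties using (lookup-injective)
open import Data.Vec.Properties using (lookup∘tabulate; tabulate-cong; []=⇒lookup; lookup⇒[]=)
open import Data.Vec.Functional using () renaming (_∷_ to infixr 5 _◂_)
open import Data.Product using (Σ; _×_; _,_; proj₁; proj₂; swap; curry)
open import Data.Product.Properties using (≡-dec)
open import Data.Sum as Sum using (_⊎_; inj₁; inj₂)
open import Data.Empty using (⊥)
open import Function using (_∘_; id)
open import Function.Bundles using (_↔_; _⇔_; mk⇔; mk⤖; Inverse)
open import Function.Definitions using (Injective; StrictlySurjective)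
open import Function.Consequences.Propositional
  using (strictlySurjective⇒surjective)
open import Function.Properties.Bijection using (⤖⇒↔)
open import Function.Properties.Inverse using (↔-refl; ↔-sym; ↔-trans)
open import Function.Properties.Equivalence using (⇔-isEquivalence)
open import Relation.Nullary using (¬_; Dec; yes; no; does; contradiction)
open import Relation.Nullary.Decidable
  using (from-yes; dec-true; dec-false; does-⇔; ¬?; _×-dec_; _⊎-dec_; _→-dec_)
open import Relation.Binary
  using (Rel; IsStrictTotalOrder; IsEquivalence; DecidableEquality; Transitive; Tri; tri<; tri≈; tri>)
open import Relation.Binary.Structures.Biased using (isStrictTotalOrderᶜ)
open import Relation.Binary.PropositionalEquality
  using (_≡_; _≢_; _≗_; refl; sym; trans; cong; cong₂; subst; subst₂; isEquivalence)
open import Level using (0ℓ)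

open Inverse using (to; from; strictlyInverseˡ; strictlyInverseʳ)

-- Injections of a finite set into itself

to-injective : {A B : Set} (σ : A ↔ B) → Injective _≡_ _≡_ (to σ)
to-injective σ {a} {b} eq =
  trans (sym (strictlyInverseʳ σ a)) (trans (cong (from σ) eq) (strictlyInverseʳ σ b))

-- If `f` missed `j`, punching `j` out of the codomain would inject a finite set into one with fewer
-- elements.
injective⇒strictlySurjective : ∀ {n} {f : Fin n → Fin n} →
  Injective _≡_ _≡_ f → StrictlySurjective _≡_ f
injective⇒strictlySurjective {zero} _ ()
injective⇒strictlySurjective {suc n} {f} inj j with any? (λ i → f i ≟ j)
... | yes hit = hit
... | no miss = contradiction
  (injective⇒≤ {f = λ i → punchOut (avoid i)}
    (λ {a} {b} eq → inj (punchOut-injective (avoid a) (avoid b) eq)))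
  ℕ.1+n≰n
  where
  avoid : ∀ i → j ≢ f i
  avoid i eq = miss (i , sym eq)

injective⇒↔ : ∀ {n} {f : Fin n → Fin n} → Injective _≡_ _≡_ f → Fin n ↔ Fin n
injective⇒↔ inj = ⤖⇒↔ (mk⤖ (inj , strictlySurjective⇒surjective (injective⇒strictlySurjective inj)))

-- Ranks in finite strict total orders

module Rank {n} {_≺_ : Rel (Fin n) 0ℓ} (isSTO : IsStrictTotalOrder _≡_ _≺_) where
  open IsStrictTotalOrder isSTO using (compare; irrefl; asym)
    renaming (_<?_ to _≺?_; trans to ≺-trans)

  below : Fin n → Subset n
  below v = Vec.tabulate (λ u → does (u ≺? v))

  ∈below : ∀ {u v} → u ≺ v → u ∈ below v
  ∈below {u} {v} u≺v =
    lookup⇒[]= u (below v) (trans (lookup∘tabulate _ u) (dec-true (u ≺? v) u≺v))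

  below∈ : ∀ {u v} → u ∈ below v → u ≺ v
  below∈ {u} {v} u∈ with u ≺? v in eq
  ... | yes u≺v = u≺v
  ... | no _ with trans (sym ([]=⇒lookup u∈)) (trans (lookup∘tabulate _ u) (cong does eq))
  ...   | ()

  rankℕ : Fin n → ℕ
  rankℕ v = ∣ below v ∣

  rankℕ-mono : ∀ {u v} → u ≺ v → rankℕ u ℕ.< rankℕ v
  rankℕ-mono u≺v = p⊂q⇒∣p∣<∣q∣
    ((λ w∈ → ∈below (≺-trans (below∈ w∈) u≺v)) , _ , ∈below u≺v , irrefl refl ∘ below∈)

  rankℕ<n : ∀ v → rankℕ v ℕ.< n
  rankℕ<n v = subst (rankℕ v ℕ.<_) (∣⊤∣≡n n)
    (p⊂q⇒∣p∣<∣q∣ (⊆⊤ , v , ∈⊤ , irrefl refl ∘ below∈))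

  rankℕ-reflects : ∀ {u v} → rankℕ u ℕ.< rankℕ v → u ≺ v
  rankℕ-reflects {u} {v} lt with compare u v
  ... | tri< u≺v _ _ = u≺v
  ... | tri≈ _ refl _ = contradiction lt (ℕ.<-irrefl refl)
  ... | tri> _ _ v≺u = contradiction (rankℕ-mono v≺u) (ℕ.<-asym lt)

  rankℕ-injective : ∀ {u v} → rankℕ u ≡ rankℕ v → u ≡ v
  rankℕ-injective {u} {v} eq with compare u v
  ... | tri< u≺v _ _ = contradiction (rankℕ-mono u≺v) (ℕ.<-irrefl eq)
  ... | tri≈ _ u≡v _ = u≡v
  ... | tri> _ _ v≺u = contradiction (rankℕ-mono v≺u) (ℕ.<-irrefl (sym eq))

  rank : Fin n → Fin n
  rank v = fromℕ< (rankℕ<n v)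

  rank↔ : Fin n ↔ Fin n
  rank↔ = injective⇒↔ {f = rank}
    (λ {u} {v} eq → rankℕ-injective (fromℕ<-injective _ _ (rankℕ<n u) (rankℕ<n v) eq))

-- Isomorphism of two finite strict total orders

module OrderIso {n} {_≺₁_ _≺₂_ : Rel (Fin n) 0ℓ}
  (sto₁ : IsStrictTotalOrder _≡_ _≺₁_) (sto₂ : IsStrictTotalOrder _≡_ _≺₂_) where

  private
    module R₁ = Rank sto₁
    module R₂ = Rank sto₂
    module S₁ = IsStrictTotalOrder sto₁
    module S₂ = IsStrictTotalOrder sto₂

  abstract
    -- Each element goes to the one of the same rank in the second order.
    order↔ : Fin n ↔ Fin n
    order↔ = ↔-trans R₁.rank↔ (↔-sym R₂.rank↔)

    rank-order↔ : ∀ u → R₂.rankℕ (to order↔ u) ≡ R₁.rankℕ u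
    rank-order↔ u = fromℕ<-injective _ _ _ (R₁.rankℕ<n u)
      (strictlyInverseˡ R₂.rank↔ (R₁.rank u))

    order↔-mono : ∀ {u v} → u ≺₁ v → to order↔ u ≺₂ to order↔ v
    order↔-mono {u} {v} u≺v = R₂.rankℕ-reflects
      (subst₂ ℕ._<_ (sym (rank-order↔ u)) (sym (rank-order↔ v)) (R₁.rankℕ-mono u≺v))

    -- Equal sets of predecessors give equal ranks. This will keep the good vertices in place when
    -- the two chains are matched.
    order↔-fixes : ∀ {u} → (∀ w → w ≺₁ u ⇔ w ≺₂ u) → to order↔ u ≡ u
    order↔-fixes {u} same = R₂.rankℕ-injective (trans (rank-order↔ u)
      (cong ∣_∣ (tabulate-cong λ w → does-⇔ (same w) (w S₁.<? u) (w S₂.<? u))))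

-- Structures given by a decidable colouring of the ordered pairs

-- Checked on all 27 triples; the six cases come in the order of the constructors of `Triangle≅`.
permutation₃-cases : ∀ (a b c : Fin 3) → a ≢ b → b ≢ c → a ≢ c →
  (a ≡ # 0 × b ≡ # 1 × c ≡ # 2) ⊎ (a ≡ # 1 × b ≡ # 2 × c ≡ # 0) ⊎
  (a ≡ # 2 × b ≡ # 0 × c ≡ # 1) ⊎ (a ≡ # 0 × b ≡ # 2 × c ≡ # 1) ⊎
  (a ≡ # 1 × b ≡ # 0 × c ≡ # 2) ⊎ (a ≡ # 2 × b ≡ # 1 × c ≡ # 0)
permutation₃-cases = from-yes (all? λ a → all? λ b → all? λ c →
  ¬? (a ≟ b) →-dec ¬? (b ≟ c) →-dec ¬? (a ≟ c) →-dec
  (is a b c (# 0) (# 1) (# 2) ⊎-dec is a b c (# 1) (# 2) (# 0) ⊎-dec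
   is a b c (# 2) (# 0) (# 1) ⊎-dec is a b c (# 0) (# 2) (# 1) ⊎-dec
   is a b c (# 1) (# 0) (# 2) ⊎-dec is a b c (# 2) (# 1) (# 0)))
  where
  is : ∀ (a b c a′ b′ c′ : Fin 3) → Dec (a ≡ a′ × b ≡ b′ × c ≡ c′)
  is a b c a′ b′ c′ = (a ≟ a′) ×-dec (b ≟ b′) ×-dec (c ≟ c′)

module Coloured {W A : Set} (_≟ᴬ_ : DecidableEquality A) (c : W → W → A) where

  Colour : Set
  Colour = A × A

  -- Recording both directions makes reversal of an arc an operation on colours.
  C : W → W → Colour
  C u v = c u v , c v u

  rev : Colour → Colour
  rev = swap

  _≟ᶜ_ : DecidableEquality Colour
  _≟ᶜ_ = ≡-dec _≟ᴬ_ _≟ᴬ_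

  Matching : ∀ {k} → (Fin k → W) → (Fin k → W) → Set
  Matching {k} f g = Σ (Fin k ↔ Fin k) λ σ → ∀ a b → C (f a) (f b) ≡ C (g (to σ a)) (g (to σ b))

  -- The three colours are read cyclically along 0, 1, 2, 0, and loops are left out. Even
  -- permutations shift the colours; odd ones also reverse them.
  data Triangle≅ (p q r p′ q′ r′ : Colour) : Set where
    rotation₀   : p ≡ p′ → q ≡ q′ → r ≡ r′ → Triangle≅ p q r p′ q′ r′
    rotation₁   : p ≡ q′ → q ≡ r′ → r ≡ p′ → Triangle≅ p q r p′ q′ r′
    rotation₂   : p ≡ r′ → q ≡ p′ → r ≡ q′ → Triangle≅ p q r p′ q′ r′
    reflection₀ : p ≡ rev r′ → q ≡ rev q′ → r ≡ rev p′ → Triangle≅ p q r p′ q′ r′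
    reflection₁ : p ≡ rev p′ → q ≡ rev r′ → r ≡ rev q′ → Triangle≅ p q r p′ q′ r′
    reflection₂ : p ≡ rev q′ → q ≡ rev p′ → r ≡ rev r′ → Triangle≅ p q r p′ q′ r′

  matching⇒triangle≅ : ∀ (f g : Fin 3 → W) → Matching f g →
    Triangle≅ (C (f (# 0)) (f (# 1))) (C (f (# 1)) (f (# 2))) (C (f (# 2)) (f (# 0)))
              (C (g (# 0)) (g (# 1))) (C (g (# 1)) (g (# 2))) (C (g (# 2)) (g (# 0)))
  matching⇒triangle≅ f g (σ , eq) =
    cases (to σ (# 0)) (to σ (# 1)) (to σ (# 2))
      (λ h → 0≢1 (to-injective σ h)) (λ h → 1≢2 (to-injective σ h)) (λ h → 0≢2 (to-injective σ h))
      (eq (# 0) (# 1)) (eq (# 1) (# 2)) (eq (# 2) (# 0))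
    where
    0≢1 : _≢_ {A = Fin 3} (# 0) (# 1)
    0≢1 ()
    1≢2 : _≢_ {A = Fin 3} (# 1) (# 2)
    1≢2 ()
    0≢2 : _≢_ {A = Fin 3} (# 0) (# 2)
    0≢2 ()
    cases : ∀ {p q r} a b c → a ≢ b → b ≢ c → a ≢ c →
      p ≡ C (g a) (g b) → q ≡ C (g b) (g c) → r ≡ C (g c) (g a) →
      Triangle≅ p q r (C (g (# 0)) (g (# 1))) (C (g (# 1)) (g (# 2))) (C (g (# 2)) (g (# 0)))
    cases a b c a≢b b≢c a≢c p q r with permutation₃-cases a b c a≢b b≢c a≢c
    ... | inj₁ (refl , refl , refl) = rotation₀ p q r
    ... | inj₂ (inj₁ (refl , refl , refl)) = rotation₁ p q r
    ... | inj₂ (inj₂ (inj₁ (refl , refl , refl))) = rotation₂ p q r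
    ... | inj₂ (inj₂ (inj₂ (inj₁ (refl , refl , refl)))) = reflection₀ p q r
    ... | inj₂ (inj₂ (inj₂ (inj₂ (inj₁ (refl , refl , refl))))) = reflection₁ p q r
    ... | inj₂ (inj₂ (inj₂ (inj₂ (inj₂ (refl , refl , refl))))) = reflection₂ p q r

  -- For `i` bad and `j` good, `α`, `γ`, `δ` are the colours of the arcs x i, x j, i j. Only
  -- `reflection₁`, which sends x to i, i to y and fixes j, avoids `α ≡ rev α`.
  mixed-triangle : ∀ {α γ δ} → α ≢ rev α →
    Triangle≅ α δ (rev γ) (rev α) δ (rev γ) → γ ≡ δ
  mixed-triangle ne (rotation₀ p _ _) = contradiction p ne
  mixed-triangle ne (rotation₁ p q r) = contradiction (trans p (trans q r)) ne
  mixed-triangle ne (rotation₂ p q r) = contradiction (trans p (trans r q)) ne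
  mixed-triangle ne (reflection₀ p _ r) = contradiction (sym (trans (cong rev p) r)) ne
  mixed-triangle ne (reflection₁ _ q _) = sym q
  mixed-triangle ne (reflection₂ p q _) = contradiction (trans p (cong rev q)) ne

  -- Here `i` and `j` are both bad, with colours `α` and `β` from x, and `δ` is the colour of i j.
  -- The two nontrivial rotations give the first alternative, and the reflection that sends x to y
  -- and exchanges i and j gives the second.
  reversed-triangle : ∀ {α β δ} → α ≢ rev α → β ≢ rev β →
    Triangle≅ α δ (rev β) (rev α) δ β →
    (α ≡ β × (δ ≡ α ⊎ δ ≡ rev α)) ⊎ (α ≡ rev β × δ ≡ rev δ)
  reversed-triangle α≢ β≢ (rotation₀ p _ _) = contradiction p α≢
  reversed-triangle α≢ β≢ (rotation₁ p q _) = inj₁ (trans p q , inj₁ (sym p))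
  reversed-triangle α≢ β≢ (rotation₂ p q _) = inj₁ (p , inj₂ q)
  reversed-triangle α≢ β≢ (reflection₀ p q _) = inj₂ (p , q)
  reversed-triangle α≢ β≢ (reflection₁ _ q r) = contradiction (trans (cong rev r) q) β≢
  reversed-triangle α≢ β≢ (reflection₂ p q _) = contradiction (trans p (cong rev q)) α≢

  asymmetric-≢ : ∀ {α β : Colour} → α ≢ rev α → β ≡ rev α → β ≢ α
  asymmetric-≢ ne β≡ β≡α = ne (trans (sym β≡α) β≡)

  -- The image of `x` would send `α` to the three other vertices. Neither `y` nor a vertex of the
  -- cycle does: the latter receives `α` from its predecessor.
  no-dominated-3-cycle : ∀ {α x y} {f : Fin 3 → W} → α ≢ rev α →
    (∀ i → C x (f i) ≡ α) → (∀ i → C y (f i) ≡ rev α) →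
    C (f (# 0)) (f (# 1)) ≡ α → C (f (# 1)) (f (# 2)) ≡ α → C (f (# 2)) (f (# 0)) ≡ α →
    ¬ Matching (x ◂ f) (y ◂ f)
  no-dominated-3-cycle {α} {x} {y} {f} ne xf yf f₀f₁ f₁f₂ f₂f₀ (σ , eq) = no-source (to σ zero) source
    where
    g : Fin 4 → W
    g = y ◂ f
    source : ∀ v → v ≢ to σ zero → C (g (to σ zero)) (g v) ≡ α
    source v v≢ with from σ v in eqw
    ... | zero = contradiction (trans (sym (strictlyInverseˡ σ v)) (cong (to σ) eqw)) v≢
    ... | suc w = trans (cong (C (g (to σ zero)) ∘ g)
                          (trans (sym (strictlyInverseˡ σ v)) (cong (to σ) eqw)))
                        (trans (sym (eq zero (suc w))) (xf w))
    no-source : ∀ u → ¬ (∀ v → v ≢ u → C (g u) (g v) ≡ α)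
    no-source zero h = asymmetric-≢ ne (yf (# 0)) (h (# 1) λ ())
    no-source (suc zero) h = asymmetric-≢ ne (cong rev f₂f₀) (h (# 3) λ ())
    no-source (suc (suc zero)) h = asymmetric-≢ ne (cong rev f₀f₁) (h (# 1) λ ())
    no-source (suc (suc (suc zero))) h = asymmetric-≢ ne (cong rev f₁f₂) (h (# 2) λ ())

  -- All arcs from `x` to the three vertices are asymmetric, while each of these three lies on a
  -- symmetric arc, so `x` must go to `y`. The first two vertices, reached from `x` by `α`, then
  -- both go to the third, the only one that `y` can reach by `α`.
  no-two-against-one : ∀ {α x y} {f : Fin 3 → W} → α ≢ rev α →
    C x (f (# 0)) ≡ α → C x (f (# 1)) ≡ α → C x (f (# 2)) ≡ rev α →
    C y (f (# 0)) ≡ rev α → C y (f (# 1)) ≡ rev α →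
    C (f (# 0)) (f (# 2)) ≡ C (f (# 2)) (f (# 0)) →
    C (f (# 1)) (f (# 2)) ≡ C (f (# 2)) (f (# 1)) →
    ¬ Matching (x ◂ f) (y ◂ f)
  no-two-against-one {α} {x} {y} {f} ne xf₀ xf₁ xf₂ yf₀ yf₁ s₀ s₁ (σ , eq) =
    images-differ (trans (image (# 1) xf₀ λ ()) (sym (image (# 2) xf₁ λ ())))
    where
    g : Fin 4 → W
    g = y ◂ f
    images-differ : to σ (# 1) ≢ to σ (# 2)
    images-differ h with to-injective σ h
    ... | ()

    symmetric-≢ : ∀ {u v} → C u v ≡ C v u → C u v ≢ α × C u v ≢ rev α
    symmetric-≢ s =
      (λ h → ne (trans (sym h) (trans s (cong rev h)))) ,
      (λ h → ne (sym (trans (sym h) (trans s (cong rev h)))))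

    xf : ∀ w → C x (f w) ≡ α ⊎ C x (f w) ≡ rev α
    xf zero = inj₁ xf₀
    xf (suc zero) = inj₁ xf₁
    xf (suc (suc zero)) = inj₂ xf₂

    asymmetric : ∀ v → v ≢ to σ zero →
      C (g (to σ zero)) (g v) ≢ C (g v) (g (to σ zero))
    asymmetric v v≢ s with from σ v in eqw
    ... | zero = contradiction (trans (sym (strictlyInverseˡ σ v)) (cong (to σ) eqw)) v≢
    ... | suc w with trans (sym (strictlyInverseˡ σ v)) (cong (to σ) eqw)
    ...   | refl with xf w
    ...     | inj₁ h = proj₁ (symmetric-≢ s) (trans (sym (eq zero (suc w))) h)
    ...     | inj₂ h = proj₂ (symmetric-≢ s) (trans (sym (eq zero (suc w))) h)

    fixes-zero : ∀ u → (∀ v → v ≢ u → C (g u) (g v) ≢ C (g v) (g u)) → u ≡ zero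
    fixes-zero zero h = refl
    fixes-zero (suc zero) h = contradiction s₀ (h (# 3) λ ())
    fixes-zero (suc (suc zero)) h = contradiction s₁ (h (# 3) λ ())
    fixes-zero (suc (suc (suc zero))) h = contradiction (sym s₀) (h (# 1) λ ())

    only-third : ∀ v → v ≢ zero → C y (g v) ≡ α → v ≡ # 3
    only-third zero v≢ h = contradiction refl v≢
    only-third (suc zero) v≢ h = contradiction h (asymmetric-≢ ne yf₀)
    only-third (suc (suc zero)) v≢ h = contradiction h (asymmetric-≢ ne yf₁)
    only-third (suc (suc (suc zero))) v≢ h = refl

    image : ∀ w → C x ((x ◂ f) w) ≡ α → w ≢ zero → to σ w ≡ # 3
    image w h w≢ with fixes-zero (to σ zero) asymmetric
    ... | fixed = only-third (to σ w)
      (λ e → w≢ (to-injective σ (trans e (sym fixed))))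
      (trans (cong (λ u → C (g u) (g (to σ w))) (sym fixed)) (trans (sym (eq zero w)) h))

  -- Good and bad vertices

  module Comparison {n} (x y : W) (e : Fin n → W)
    (small : ∀ {m} → m ≤ 3 → (v : Vec (Fin n) m) → Unique v →
             Matching (x ◂ e ∘ lookup v) (y ◂ e ∘ lookup v)) where

    Good Bad : Fin n → Set
    Good i = C x (e i) ≡ C y (e i)
    Bad i = ¬ Good i

    good? : ∀ i → Dec (Good i)
    good? i = C x (e i) ≟ᶜ C y (e i)

    -- The case of the empty set.
    loop-xy : C x x ≡ C y y
    loop-xy with small z≤n [] []
    ... | σ , eq with to σ zero | eq zero zero
    ...   | zero | h = h

    -- A matching on two vertices either sends x to y and fixes i, or sends x to i and i to y.
    single : ∀ i → Good i ⊎ (C y (e i) ≡ rev (C x (e i)) × C (e i) (e i) ≡ C x x)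
    single i with small (s≤s z≤n) (i ∷ []) ([] ∷ [])
    ... | σ , eq with to σ (# 0) in eq₀ | to σ (# 1) in eq₁ | eq (# 0) (# 1) | eq (# 0) (# 0)
    ...   | zero | zero | _ | _ with to-injective σ (trans eq₀ (sym eq₁))
    ...     | ()
    single i | σ , eq | zero | suc zero | h | _ = inj₁ h
    single i | σ , eq | suc zero | zero | h | l = inj₂ (sym (cong rev h) , sym l)
    single i | σ , eq | suc zero | suc zero | _ | _ with to-injective σ (trans eq₀ (sym eq₁))
    ...     | ()

    y-bad : ∀ {i} → Bad i → C y (e i) ≡ rev (C x (e i))
    y-bad {i} bad with single i
    ... | inj₁ good = contradiction good bad
    ... | inj₂ (h , _) = h

    loop-bad : ∀ {i} → Bad i → C (e i) (e i) ≡ C x x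
    loop-bad {i} bad with single i
    ... | inj₁ good = contradiction good bad
    ... | inj₂ (_ , h) = h

    bad-asymmetric : ∀ {i} → Bad i → C x (e i) ≢ rev (C x (e i))
    bad-asymmetric bad h = bad (trans h (sym (y-bad bad)))

    good≢bad : ∀ {i j} → Good j → Bad i → i ≢ j
    good≢bad good bad refl = bad good

    triangle : ∀ {i j} → i ≢ j →
      Triangle≅ (C x (e i)) (C (e i) (e j)) (C (e j) x) (C y (e i)) (C (e i) (e j)) (C (e j) y)
    triangle {i} {j} i≢j =
      matching⇒triangle≅ (x ◂ e ∘ lookup (i ∷ j ∷ [])) (y ◂ e ∘ lookup (i ∷ j ∷ []))
        (small (s≤s (s≤s z≤n)) (i ∷ j ∷ []) ((i≢j ∷ []) ∷ [] ∷ []))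

    relation : ∀ {i j} → Bad i → Bad j → i ≢ j →
      (C x (e i) ≡ C x (e j) × (C (e i) (e j) ≡ C x (e i) ⊎ C (e i) (e j) ≡ rev (C x (e i)))) ⊎
      (C x (e i) ≡ rev (C x (e j)) × C (e i) (e j) ≡ C (e j) (e i))
    relation {i} {j} bi bj i≢j = reversed-triangle (bad-asymmetric bi) (bad-asymmetric bj)
      (subst₂ (λ p r → Triangle≅ (C x (e i)) (C (e i) (e j)) (C (e j) x) p (C (e i) (e j)) r)
        (y-bad bi) (cong rev (y-bad bj))
        (triangle i≢j))

    twin : ∀ {i j} → Bad i → Good j → C x (e j) ≡ C (e i) (e j)
    twin {i} {j} bi gj = mixed-triangle (bad-asymmetric bi)
      (subst₂ (λ p r → Triangle≅ (C x (e i)) (C (e i) (e j)) (C (e j) x) p (C (e i) (e j)) r)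
        (y-bad bi) (cong rev (sym gj))
        (triangle (good≢bad gj bi)))

    all-distinct : ∀ {i j k : Fin n} → i ≢ j → i ≢ k → j ≢ k → Unique (i ∷ j ∷ k ∷ [])
    all-distinct i≢j i≢k j≢k = (i≢j ∷ i≢k ∷ []) ∷ (j≢k ∷ []) ∷ [] ∷ []

    -- By `relation`, k is joined symmetrically to i and to j, so `no-two-against-one` applies. That
    -- k differs from both follows from the asymmetry of their colours.
    no-split : ∀ {i j k} → Bad i → Bad j → Bad k → i ≢ j →
      C x (e i) ≡ C x (e j) → C x (e k) ≢ rev (C x (e i))
    no-split {i} {j} {k} bi bj bk i≢j ij ki =
      no-two-against-one (bad-asymmetric bi) refl (sym ij) ki (y-bad bi)
        (trans (y-bad bj) (cong rev (sym ij))) (symmetric bi (cong rev (sym ki)) i≢k)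
        (symmetric bj (trans (sym ij) (cong rev (sym ki))) j≢k)
        (small (s≤s (s≤s (s≤s z≤n))) (i ∷ j ∷ k ∷ []) (all-distinct i≢j i≢k j≢k))
      where
      i≢k : i ≢ k
      i≢k refl = bad-asymmetric bi ki
      j≢k : j ≢ k
      j≢k refl = bad-asymmetric bj (trans ki (cong rev ij))
      symmetric : ∀ {l} → Bad l → C x (e l) ≡ rev (C x (e k)) → l ≢ k → C (e l) (e k) ≡ C (e k) (e l)
      symmetric bl h l≢k with relation bl bk l≢k
      ... | inj₁ (h′ , _) = contradiction (trans (sym h′) h) (bad-asymmetric bk)
      ... | inj₂ (_ , s) = s

    -- Good vertices cannot tell x, y and the bad vertices apart, so it is enough to match the others.

    Fixed : Fin (suc n) → Set
    Fixed zero = ⊥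
    Fixed (suc i) = Good i

    fixed? : ∀ u → Dec (Fixed u)
    fixed? zero = no id
    fixed? (suc i) = good? i

    loop-x : ∀ {u} → ¬ Fixed u → C ((x ◂ e) u) ((x ◂ e) u) ≡ C x x
    loop-x {zero} _ = refl
    loop-x {suc i} bad = loop-bad bad

    loop-y : ∀ {u} → ¬ Fixed u → C ((y ◂ e) u) ((y ◂ e) u) ≡ C x x
    loop-y {zero} _ = sym loop-xy
    loop-y {suc i} bad = loop-bad bad

    twin-x : ∀ {u i} → ¬ Fixed u → Good i → C ((x ◂ e) u) (e i) ≡ C x (e i)
    twin-x {zero} _ _ = refl
    twin-x {suc i} bad good = sym (twin bad good)

    twin-y : ∀ {u i} → ¬ Fixed u → Good i → C ((y ◂ e) u) (e i) ≡ C x (e i)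
    twin-y {zero} _ good = sym good
    twin-y {suc i} bad good = sym (twin bad good)

    extend-by-good : (σ : Fin (suc n) ↔ Fin (suc n)) →
      (∀ i → Good i → to σ (suc i) ≡ suc i) →
      (∀ u v → ¬ Fixed u → ¬ Fixed v →
        C ((x ◂ e) u) ((x ◂ e) v) ≡ C ((y ◂ e) (to σ u)) ((y ◂ e) (to σ v))) →
      Matching (x ◂ e) (y ◂ e)
    extend-by-good σ fix moved = σ , matches
      where
      -- A good `to σ u` is also its own image, so injectivity would make `u` that good vertex.
      unfixed : ∀ {u} → ¬ Fixed u → ¬ Fixed (to σ u)
      unfixed {u} nu fu with to σ u in eq
      ... | suc i = nu (subst Fixed (to-injective σ (trans (fix i fu) (sym eq))) fu)

      cross : ∀ u i → ¬ Fixed u → Good i →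
        C ((x ◂ e) u) (e i) ≡ C ((y ◂ e) (to σ u)) ((y ◂ e) (to σ (suc i)))
      cross u i nu gi = trans (twin-x {u} nu gi) (trans (sym (twin-y {to σ u} (unfixed nu) gi))
        (cong (C ((y ◂ e) (to σ u)) ∘ (y ◂ e)) (sym (fix i gi))))

      matches : ∀ u v → C ((x ◂ e) u) ((x ◂ e) v) ≡ C ((y ◂ e) (to σ u)) ((y ◂ e) (to σ v))
      matches u v with fixed? u | fixed? v
      matches u v | no nu | no nv = moved u v nu nv
      matches u (suc j) | no nu | yes gj = cross u j nu gj
      matches (suc i) v | yes gi | no nv = cong rev (cross v i nv gi)
      matches (suc i) (suc j) | yes gi | yes gj =
        cong₂ (λ u v → C ((y ◂ e) u) ((y ◂ e) v)) (sym (fix i gi)) (sym (fix j gj))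

    -- All bad vertices of the same colour: two chains

    module Chain (α : Colour) (asym : α ≢ rev α) (bad-α : ∀ {i} → Bad i → C x (e i) ≡ α) where

      -- The colour of a loop is its own reverse.
      arc-irrefl : ∀ {u} → C u u ≢ α
      arc-irrefl h = asym (trans (sym h) (cong rev h))

      no-3-cycle : ∀ {i j k} → Bad i → Bad j → Bad k →
        C (e i) (e j) ≡ α → C (e j) (e k) ≡ α → C (e k) (e i) ≢ α
      no-3-cycle {i} {j} {k} bi bj bk ij jk ki =
        no-dominated-3-cycle asym x-all y-all ij jk ki
          (small (s≤s (s≤s (s≤s z≤n))) (i ∷ j ∷ k ∷ [])
            (all-distinct (λ { refl → arc-irrefl ij }) (λ { refl → arc-irrefl ki })
              (λ { refl → arc-irrefl jk })))
        where
        bad : ∀ l → Bad (lookup (i ∷ j ∷ k ∷ []) l)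
        bad zero = bi
        bad (suc zero) = bj
        bad (suc (suc zero)) = bk
        x-all : ∀ l → C x (e (lookup (i ∷ j ∷ k ∷ []) l)) ≡ α
        x-all l = bad-α (bad l)
        y-all : ∀ l → C y (e (lookup (i ∷ j ∷ k ∷ []) l)) ≡ rev α
        y-all l = trans (y-bad (bad l)) (cong rev (bad-α (bad l)))

      arc-total-bad : ∀ {i j} → Bad i → Bad j → i ≢ j →
        C (e i) (e j) ≡ α ⊎ C (e j) (e i) ≡ α
      arc-total-bad bi bj i≢j with relation bi bj i≢j
      ... | inj₁ (_ , inj₁ h) = inj₁ (trans h (bad-α bi))
      ... | inj₁ (_ , inj₂ h) = inj₂ (trans (cong rev h) (bad-α bi))
      ... | inj₂ (h , _) =
        contradiction (trans (sym (bad-α bi)) (trans h (cong rev (bad-α bj)))) asym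

      -- By totality the only alternative is an `α`-arc from k back to i, which would close a
      -- 3-cycle.
      arc-trans-bad : ∀ {i j k} → Bad i → Bad j → Bad k →
        C (e i) (e j) ≡ α → C (e j) (e k) ≡ α → C (e i) (e k) ≡ α
      arc-trans-bad {i} {j} {k} bi bj bk ij jk with i ≟ k
      ... | yes refl = contradiction (trans (sym ij) (cong rev jk)) asym
      ... | no i≢k with arc-total-bad bi bk i≢k
      ...   | inj₁ ik = ik
      ...   | inj₂ ki = contradiction ki (no-3-cycle bi bj bk ij jk)

      -- The unfixed vertices are ordered by their α-arcs, with z = x (κ = α) least
      -- or z = y (κ = rev α) greatest; the fixed ones precede them so that they keep their ranks.
      module Order (z : W) (κ : Colour) (κ-cases : κ ≡ α ⊎ κ ≡ rev α)
        (z-bad : ∀ {i} → Bad i → C z (e i) ≡ κ) where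

        data _≺_ (u v : Fin (suc n)) : Set where
          fixed<      : Fixed u → Fixed v → u Fin.< v → u ≺ v
          fixed-moved : Fixed u → ¬ Fixed v → u ≺ v
          arc         : ¬ Fixed u → ¬ Fixed v → C ((z ◂ e) u) ((z ◂ e) v) ≡ α → u ≺ v

        rev-κ≢α : κ ≡ α → rev κ ≢ α
        rev-κ≢α h h′ = asym (trans (sym h) (cong rev h′))

        -- All arcs from `z` to bad vertices have colour `κ`, so `z` is below all of them or above
        -- all of them. With `z` in the middle, or at both ends around a bad vertex, both `κ` and
        -- `rev κ` would be `α`.
        arc-trans : ∀ u v w → ¬ Fixed u → ¬ Fixed v → ¬ Fixed w →
          C ((z ◂ e) u) ((z ◂ e) v) ≡ α → C ((z ◂ e) v) ((z ◂ e) w) ≡ α →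
          C ((z ◂ e) u) ((z ◂ e) w) ≡ α
        arc-trans zero zero _ _ _ _ uv vw = vw
        arc-trans _ zero zero _ _ _ uv vw = uv
        arc-trans zero (suc j) zero _ bj _ uv vw =
          contradiction (trans (cong rev (sym (z-bad bj))) vw) (rev-κ≢α (trans (sym (z-bad bj)) uv))
        arc-trans zero (suc j) (suc k) _ bj bk uv vw = trans (z-bad bk) (trans (sym (z-bad bj)) uv)
        arc-trans (suc i) zero (suc k) bi _ bk uv vw =
          contradiction (trans (cong rev (sym (z-bad bi))) uv) (rev-κ≢α (trans (sym (z-bad bk)) vw))
        arc-trans (suc i) (suc j) zero bi bj _ uv vw =
          trans (cong rev (trans (z-bad bi) (sym (z-bad bj)))) vw
        arc-trans (suc i) (suc j) (suc k) bi bj bk uv vw = arc-trans-bad bi bj bk uv vw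

        arc-total : ∀ u v → ¬ Fixed u → ¬ Fixed v → u ≢ v →
          C ((z ◂ e) u) ((z ◂ e) v) ≡ α ⊎ C ((z ◂ e) v) ((z ◂ e) u) ≡ α
        arc-total zero zero _ _ u≢v = contradiction refl u≢v
        arc-total zero (suc j) _ bj _ =
          Sum.map (trans (z-bad bj)) (cong rev ∘ trans (z-bad bj)) κ-cases
        arc-total (suc i) zero bi _ _ =
          Sum.swap (Sum.map (trans (z-bad bi)) (cong rev ∘ trans (z-bad bi)) κ-cases)
        arc-total (suc i) (suc j) bi bj u≢v = arc-total-bad bi bj (u≢v ∘ cong suc)

        ≺-trans : Transitive _≺_
        ≺-trans (fixed< fu _ u<v) (fixed< _ fw v<w) = fixed< fu fw (ℕ.<-trans u<v v<w)
        ≺-trans (fixed< fu _ _) (fixed-moved _ nw) = fixed-moved fu nw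
        ≺-trans (fixed< _ fv _) (arc nv _ _) = contradiction fv nv
        ≺-trans (fixed-moved _ nv) (fixed< fv _ _) = contradiction fv nv
        ≺-trans (fixed-moved _ nv) (fixed-moved fv _) = contradiction fv nv
        ≺-trans (fixed-moved fu _) (arc _ nw _) = fixed-moved fu nw
        ≺-trans (arc _ nv _) (fixed< fv _ _) = contradiction fv nv
        ≺-trans (arc _ nv _) (fixed-moved fv _) = contradiction fv nv
        ≺-trans {u} {v} {w} (arc nu nv uv) (arc _ nw vw) =
          arc nu nw (arc-trans u v w nu nv nw uv vw)

        ≺-irrefl : ∀ {u} → ¬ (u ≺ u)
        ≺-irrefl (fixed< _ _ u<u) = ℕ.<-irrefl refl u<u
        ≺-irrefl (fixed-moved fu nu) = nu fu
        ≺-irrefl (arc _ _ uu) = arc-irrefl uu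

        ≺-total : ∀ u v → u ≢ v → u ≺ v ⊎ v ≺ u
        ≺-total u v u≢v with fixed? u | fixed? v
        ... | yes fu | no nv = inj₁ (fixed-moved fu nv)
        ... | no nu | yes fv = inj₂ (fixed-moved fv nu)
        ... | yes fu | yes fv with <-cmp u v
        ...   | tri< u<v _ _ = inj₁ (fixed< fu fv u<v)
        ...   | tri≈ _ u≡v _ = contradiction u≡v u≢v
        ...   | tri> _ _ v<u = inj₂ (fixed< fv fu v<u)
        ≺-total u v u≢v | no nu | no nv with arc-total u v nu nv u≢v
        ...   | inj₁ uv = inj₁ (arc nu nv uv)
        ...   | inj₂ vu = inj₂ (arc nv nu vu)

        ≺-compare : ∀ u v → Tri (u ≺ v) (u ≡ v) (v ≺ u)
        ≺-compare u v with u ≟ v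
        ... | yes refl = tri≈ ≺-irrefl refl ≺-irrefl
        ... | no u≢v with ≺-total u v u≢v
        ...   | inj₁ u≺v = tri< u≺v u≢v (≺-irrefl ∘ ≺-trans u≺v)
        ...   | inj₂ v≺u = tri> (≺-irrefl ∘ ≺-trans v≺u) u≢v v≺u

        ≺-isStrictTotalOrder : IsStrictTotalOrder _≡_ _≺_
        ≺-isStrictTotalOrder = isStrictTotalOrderᶜ (record
          { isEquivalence = isEquivalence ; trans = ≺-trans ; compare = ≺-compare })

      module X = Order x α (inj₁ refl) bad-α
      module Y = Order y (rev α) (inj₂ refl) (λ bad → trans (y-bad bad) (cong rev (bad-α bad)))
      open OrderIso X.≺-isStrictTotalOrder Y.≺-isStrictTotalOrder

      -- In either order, only good vertices of smaller index precede a good vertex.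
      below-fixed : ∀ {u} → Fixed u → ∀ w → (w X.≺ u) ⇔ (w Y.≺ u)
      below-fixed fu w = mk⇔
        (λ { (X.fixed< a b c) → Y.fixed< a b c
           ; (X.fixed-moved _ nu) → contradiction fu nu
           ; (X.arc _ nu _) → contradiction fu nu })
        (λ { (Y.fixed< a b c) → X.fixed< a b c
           ; (Y.fixed-moved _ nu) → contradiction fu nu
           ; (Y.arc _ nu _) → contradiction fu nu })

      -- The order isomorphism preserves `α`-arcs. Two distinct unfixed vertices are joined by `α`
      -- in one direction, which determines the colour in the other, and all loops at unfixed
      -- vertices agree.
      chain-matching : Matching (x ◂ e) (y ◂ e)
      chain-matching = extend-by-good order↔ fixes moved
        where
        σ : Fin (suc n) → Fin (suc n)
        σ = to order↔

        fixes : ∀ i → Good i → σ (suc i) ≡ suc i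
        fixes i gi = order↔-fixes (below-fixed {suc i} gi)

        unfixed : ∀ {u} → ¬ Fixed u → ¬ Fixed (σ u)
        -- A good `σ u` is fixed by `σ`, hence equals `u` by injectivity.
        unfixed {u} nu fσu = nu (subst Fixed (to-injective order↔ (order↔-fixes (below-fixed fσu))) fσu)

        arc-moved : ∀ {u v} → ¬ Fixed u → ¬ Fixed v → C ((x ◂ e) u) ((x ◂ e) v) ≡ α →
          C ((y ◂ e) (σ u)) ((y ◂ e) (σ v)) ≡ α
        arc-moved {u} {v} nu nv uv with order↔-mono (X.arc nu nv uv)
        ... | Y.fixed< fu _ _ = contradiction fu (unfixed nu)
        ... | Y.fixed-moved fu _ = contradiction fu (unfixed nu)
        ... | Y.arc _ _ h = h

        moved : ∀ u v → ¬ Fixed u → ¬ Fixed v →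
          C ((x ◂ e) u) ((x ◂ e) v) ≡ C ((y ◂ e) (σ u)) ((y ◂ e) (σ v))
        moved u v nu nv with u ≟ v
        ... | yes refl = trans (loop-x {u} nu) (sym (loop-y {σ u} (unfixed nu)))
        ... | no u≢v with X.arc-total u v nu nv u≢v
        ...   | inj₁ uv = trans uv (sym (arc-moved nu nv uv))
        ...   | inj₂ vu = cong rev (trans vu (sym (arc-moved nv nu vu)))

    -- Two bad vertices of opposite colours

    module Opposite {i j} (bi : Bad i) (bj : Bad j) (opposite : C x (e i) ≡ rev (C x (e j))) where

      i≢j : i ≢ j
      i≢j refl = bad-asymmetric bi opposite

      -- By `relation`, a third bad vertex would share the colour of i or of j, with the other one
      -- against the two.
      bad-cases : ∀ {k} → Bad k → k ≡ i ⊎ k ≡ j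
      bad-cases {k} bk with k ≟ i | k ≟ j
      ... | yes k≡i | _ = inj₁ k≡i
      ... | no _ | yes k≡j = inj₂ k≡j
      ... | no k≢i | no k≢j with relation bi bk (k≢i ∘ sym)
      ...   | inj₁ (h , _) = contradiction (cong rev (sym opposite)) (no-split bi bk bj (k≢i ∘ sym) h)
      ...   | inj₂ (h , _) = contradiction opposite
        (no-split bj bk bi (k≢j ∘ sym) (trans (cong rev (sym opposite)) (cong rev h)))

      i↔j-symmetric : C (e i) (e j) ≡ C (e j) (e i)
      i↔j-symmetric with relation bi bj i≢j
      ... | inj₁ (h , _) = contradiction (trans (sym h) opposite) (bad-asymmetric bj)
      ... | inj₂ (_ , s) = s

      τ : Fin (suc n) ↔ Fin (suc n)
      τ = transpose (suc i) (suc j)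

      τ-i : to τ (suc i) ≡ suc j
      τ-i rewrite dec-true (suc i ≟ suc i) refl = refl

      τ-j : to τ (suc j) ≡ suc i
      τ-j rewrite dec-false (suc j ≟ suc i) (i≢j ∘ sym ∘ suc-injective)
                | dec-true (suc j ≟ suc j) refl = refl

      τ-fixes : ∀ k → Good k → to τ (suc k) ≡ suc k
      τ-fixes k gk rewrite dec-false (suc k ≟ suc i) (good≢bad gk bi ∘ sym ∘ suc-injective)
                         | dec-false (suc k ≟ suc j) (good≢bad gk bj ∘ sym ∘ suc-injective) = refl

      -- The graph of `τ` on the unfixed vertices, so that the nine pairs can be treated by pattern
      -- matching.
      data Moved : Fin (suc n) → Fin (suc n) → Set where
        origin : Moved zero zero
        first  : Moved (suc i) (suc j)
        second : Moved (suc j) (suc i)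

      τ-moved : ∀ u → ¬ Fixed u → Moved u (to τ u)
      τ-moved zero _ = origin
      τ-moved (suc k) bk with bad-cases bk
      ... | inj₁ refl = subst (Moved (suc i)) (sym τ-i) first
      ... | inj₂ refl = subst (Moved (suc j)) (sym τ-j) second

      -- Passing from x to y reverses the colours of i and j, and exchanging i and j reverses them
      -- back.
      x-i : C x (e i) ≡ C y (e j)
      x-i = trans opposite (sym (y-bad bj))

      x-j : C x (e j) ≡ C y (e i)
      x-j = trans (cong rev (sym opposite)) (sym (y-bad bi))

      loops : C (e i) (e i) ≡ C (e j) (e j)
      loops = trans (loop-bad bi) (sym (loop-bad bj))

      moved-matches : ∀ {u v u′ v′} → Moved u u′ → Moved v v′ →
        C ((x ◂ e) u) ((x ◂ e) v) ≡ C ((y ◂ e) u′) ((y ◂ e) v′)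
      moved-matches origin origin = loop-xy
      moved-matches origin first = x-i
      moved-matches origin second = x-j
      moved-matches first origin = cong rev x-i
      moved-matches first first = loops
      moved-matches first second = i↔j-symmetric
      moved-matches second origin = cong rev x-j
      moved-matches second first = sym i↔j-symmetric
      moved-matches second second = sym loops

      opposite-matching : Matching (x ◂ e) (y ◂ e)
      opposite-matching = extend-by-good τ τ-fixes
        (λ u v nu nv → moved-matches (τ-moved u nu) (τ-moved v nv))

    matching : Matching (x ◂ e) (y ◂ e)
    matching with any? (λ i → ¬? (good? i))
    -- Only the index `zero` is unfixed, so the identity, taking x to y, is a matching.
    ... | no all-good = extend-by-good ↔-refl (λ _ _ → refl) only-origin
      where
      only-origin : ∀ u v → ¬ Fixed u → ¬ Fixed v → C ((x ◂ e) u) ((x ◂ e) v) ≡ C ((y ◂ e) u) ((y ◂ e) v)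
      only-origin zero zero _ _ = loop-xy
      only-origin (suc i) _ bi _ = contradiction (i , bi) all-good
      only-origin zero (suc j) _ bj = contradiction (j , bj) all-good
    ... | yes (i , bi) with any? (λ j → ¬? (good? j) ×-dec (C x (e i) ≟ᶜ rev (C x (e j))))
    ...   | yes (j , bj , opposite) = Opposite.opposite-matching bi bj opposite
    -- No bad vertex is opposite to i, so `relation` leaves them all with the colour of i.
    ...   | no none = Chain.chain-matching (C x (e i)) (bad-asymmetric bi) same
      where
      same : ∀ {j} → Bad j → C x (e j) ≡ C x (e i)
      same {j} bj with i ≟ j
      ... | yes refl = refl
      ... | no i≢j with relation bi bj i≢j
      ...   | inj₁ (h , _) = sym h
      ...   | inj₂ (h , _) = contradiction (j , bj , h) none

-- Decidable colourings refining an undecidable equivalence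

module Attainment {D : Set} (_≟ᴰ_ : DecidableEquality D)
  {_≈_ : Rel D 0ℓ} (isEq : IsEquivalence _≈_) where
  private module ≈ = IsEquivalence isEq

  Sound : (D → D) → Set
  Sound c = ∀ {p q} → c p ≡ c q → p ≈ q

  _⊑_ : (D → D) → (D → D) → Set
  c ⊑ c′ = ∀ {p q} → c p ≡ c q → c′ p ≡ c′ q

  -- Q can be forced, permanently, by coarsening any sound colouring.
  Attainable : ((D → D) → Set) → Set
  Attainable Q = ∀ {c} → Sound c → Σ (D → D) λ c′ → Sound c′ × c ⊑ c′ × (∀ {c″} → c′ ⊑ c″ → Q c″)

  attain : ∀ {Q} → Attainable Q → Σ (D → D) λ c → Sound c × Q c
  -- The identity is the finest colouring, and it is sound by reflexivity alone.
  attain a with a {id} (λ { refl → ≈.refl })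
  ... | c , sound , _ , q = c , sound , q id

  attainable-map : ∀ {P Q} → (∀ {c} → P c → Q c) → Attainable P → Attainable Q
  attainable-map f a sound with a sound
  ... | c′ , sound′ , ⊑′ , p = c′ , sound′ , ⊑′ , λ h → f (p h)

  -- When `P` fails, the colouring is kept and the implication is vacuous.
  attainable-dec : ∀ {P Q} → Dec P → (P → Attainable Q) → Attainable (λ c → P → Q c)
  attainable-dec (yes p) a = attainable-map (λ q _ → q) (a p)
  attainable-dec (no ¬p) a {c} sound = c , sound , id , λ _ p → contradiction p ¬p

  -- What has been forced survives further coarsening, so the conditions can be forced one after
  -- another.
  attainable-∀Fin : ∀ {n} {Q : Fin n → (D → D) → Set} →
    (∀ i → Attainable (Q i)) → Attainable (λ c → ∀ i → Q i c)
  attainable-∀Fin {zero} a {c} sound = c , sound , id , λ _ ()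
  attainable-∀Fin {suc n} {Q} a sound with a zero sound
  ... | c₁ , sound₁ , ⊑₁ , q₁ with attainable-∀Fin {n} {Q ∘ suc} (a ∘ suc) sound₁
  ...   | c₂ , sound₂ , ⊑₂ , q₂ = c₂ , sound₂ , (λ h → ⊑₂ (⊑₁ h)) ,
    λ ⊑₃ → λ { zero → q₁ (λ h → ⊑₃ (⊑₂ h)) ; (suc i) → q₂ ⊑₃ i }

  attainable-∀Vec : ∀ {n} m {Q : Vec (Fin n) m → (D → D) → Set} →
    (∀ v → Attainable (Q v)) → Attainable (λ c → ∀ v → Q v c)
  attainable-∀Vec zero a = attainable-map (λ { q [] → q }) (a [])
  attainable-∀Vec (suc m) a = attainable-map (λ { q (i ∷ v) → q i v })
    (attainable-∀Fin λ i → attainable-∀Vec m λ v → a (i ∷ v))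

  -- The colour class of `p` receives the colour of `q`. Soundness survives since `p ≈ q` links the
  -- two merged classes.
  attainable-≡ : ∀ {p q} → p ≈ q → Attainable (λ c → c p ≡ c q)
  attainable-≡ {p} {q} p≈q {c} sound =
    merge , merge-sound , cong recolour , λ ⊑′ → ⊑′ p-q
    where
    recolour : D → D
    recolour z with z ≟ᴰ c p
    ... | yes _ = c q
    ... | no _ = z

    merge : D → D
    merge = recolour ∘ c

    merge-sound : Sound merge
    merge-sound {u} {v} h with c u ≟ᴰ c p | c v ≟ᴰ c p
    ... | yes u~p | yes v~p = sound (trans u~p (sym v~p))
    ... | yes u~p | no _ = ≈.trans (sound u~p) (≈.trans p≈q (sound h))
    ... | no _ | yes v~p = ≈.trans (sound h) (≈.trans (≈.sym p≈q) (sound (sym v~p)))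
    ... | no _ | no _ = sound h

    p-q : merge p ≡ merge q
    p-q with c p ≟ᴰ c p | c q ≟ᴰ c p
    ... | yes _ | yes _ = refl
    ... | yes _ | no _ = refl
    ... | no ne | _ = contradiction refl ne

-- From the structure to a colouring and back

restrict-cong : ∀ {k m} {V : Set} (R : BinStr k V) {f f′ g g′ : Fin m → V} →
  f ≗ f′ → g ≗ g′ → Iso (restrict R f) (restrict R g) → Iso (restrict R f′) (restrict R g′)
restrict-cong R f≗ g≗ (σ , iso) = σ , λ i a b →
  subst₂ _⇔_ (cong₂ (R i) (f≗ a) (f≗ b)) (cong₂ (R i) (g≗ (to σ a)) (g≗ (to σ b))) (iso i a b)

module Extension {k n} {V : Set} (R : BinStr k V) (x y : V) (sim : Sim≤ R 3 x y)
  (f : Fin n → V) (avoiding : SubsetAvoiding x y n f) where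

  -- Separate indices for `x` and `y`, followed by those of `f`. As `x ≡ y` is allowed, `vertex` may
  -- fail to be injective.
  W : Set
  W = Fin (suc (suc n))

  vertex : W → V
  vertex = x ◂ y ◂ f

  origin₁ origin₂ : W
  origin₁ = # 0
  origin₂ = # 1

  e : Fin n → W
  e i = suc (suc i)

  _≈_ : Rel (W × W) 0ℓ
  (u , v) ≈ (u′ , v′) = ∀ i → R i (vertex u) (vertex v) ⇔ R i (vertex u′) (vertex v′)

  ≈-isEquivalence : IsEquivalence _≈_
  ≈-isEquivalence = record
    { refl = λ _ → ⇔.refl
    ; sym = λ h i → ⇔.sym (h i)
    ; trans = λ h h′ i → ⇔.trans (h i) (h′ i) }
    where module ⇔ = IsEquivalence (⇔-isEquivalence {ℓ = 0ℓ})

  _≟ᴰ_ : DecidableEquality (W × W)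
  _≟ᴰ_ = ≡-dec _≟_ _≟_

  open Attainment _≟ᴰ_ ≈-isEquivalence
  open Coloured {W} _≟ᴰ_ using (Matching)

  vertex-◂ : ∀ {m} (w : W) (g : Fin m → Fin n) →
    vertex ∘ (w ◂ e ∘ g) ≗ vertex w ◂ f ∘ g
  vertex-◂ w g zero = refl
  vertex-◂ w g (suc i) = refl

  Small : ∀ m → (W × W → W × W) → Set
  Small m c = (v : Vec (Fin n) m) → Unique v →
    Matching (curry c) (origin₁ ◂ e ∘ lookup v) (origin₂ ◂ e ∘ lookup v)

  -- The given `σ` is kept, and the finitely many equalities of colours that it demands are forced
  -- in turn.
  attainable-matching : ∀ {m} {g g′ : Fin m → W} →
    Iso (restrict R (vertex ∘ g)) (restrict R (vertex ∘ g′)) →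
    Attainable (λ c → Matching (curry c) g g′)
  attainable-matching {g = g} {g′} (σ , iso) =
    attainable-map (λ h → σ , λ a b → cong₂ _,_ (h a b) (h b a))
      (attainable-∀Fin λ a → attainable-∀Fin λ b →
        attainable-≡ {g a , g b} {g′ (to σ a) , g′ (to σ b)} (λ i → iso i a b))

  attainable-small : ∀ {m} → m ≤ 3 → Attainable (Small m)
  attainable-small {m} m≤3 = attainable-∀Vec m λ v →
    attainable-dec (allPairs? (λ i j → ¬? (i ≟ j)) v) λ unique →
    attainable-matching {g′ = origin₂ ◂ e ∘ lookup v} (restrict-cong R
      (sym ∘ vertex-◂ origin₁ (lookup v)) (sym ∘ vertex-◂ origin₂ (lookup v))
      (sim m m≤3 (f ∘ lookup v)
        ( (λ eq → lookup-injective unique _ _ (proj₁ avoiding eq))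
        , proj₁ (proj₂ avoiding) ∘ lookup v
        , proj₂ (proj₂ avoiding) ∘ lookup v)))

  abstract
    -- One colouring serves all sizes from 0 to 3, hence `Fin 4`.
    colouring : Σ (W × W → W × W) λ c → Sound c × (∀ (m : Fin 4) → Small (toℕ m) c)
    colouring = attain (attainable-∀Fin λ m → attainable-small (ℕ.≤-pred (Fin.toℕ<n m)))

  c : W × W → W × W
  c = proj₁ colouring

  small : ∀ {m} → m ≤ 3 → Small m c
  small m≤3 = subst (λ m → Small m c) (Fin.toℕ-fromℕ< (s≤s m≤3))
    (proj₂ (proj₂ colouring) (fromℕ< (s≤s m≤3)))

  -- By soundness, arcs of equal colour satisfy the same relations of `R`.
  matching⇒iso : ∀ {m} {g g′ : Fin m → W} → Matching (curry c) g g′ →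
    Iso (restrict R (vertex ∘ g)) (restrict R (vertex ∘ g′))
  matching⇒iso (σ , eq) = σ , λ i a b → proj₁ (proj₂ colouring) (cong proj₁ (eq a b)) i

  extension : SimF R x y f
  extension = restrict-cong R (vertex-◂ origin₁ id) (vertex-◂ origin₂ id)
    (matching⇒iso {g′ = origin₂ ◂ e}
      (Coloured.Comparison.matching _≟ᴰ_ (curry c) origin₁ origin₂ e small))

theorem8p17 : (k : ℕ) (V : Set) (R : BinStr k V) (x y : V) →
  (Sim≤ R 3 x y → SimAll R x y) × (SimAll R x y → Sim≤ R 3 x y)
theorem8p17 k V R x y =
  (λ sim m f avoiding → Extension.extension R x y sim f avoiding) , (λ sim m _ → sim m)
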